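{- There exist a carrier kind, a declared regime $\tau$ for it with sibling $\tau'=\mathrm{Sib}(\tau)$, a finite record domain $R$ of that kind with a family-labeled history $H$ over $R$ using the imported transformation families, and an audit surface $d$ over $R$, such that $d$ exhibits sibling-aligned divergence (with respect to $\tau$ on $R$) and $d$ does not exhibit regime substitution on $R$.
   Context: Regimes and declared identity. $\mathcal{F}$ is a finite set of transformation families. An identity regime $\rho$ carries a classification function $\mathrm{Class}_\rho:\mathcal{F}\to\{\mathsf{PRS},\mathsf{BRK},\mathsf{NEU},\mathsf{N/A}\}$ (preserving, breaking, neutral, not applicable). A history over $R$ is a finite sequence $H=\langle(f_i,x_i,y_i)\rangle_{i=1}^n$ with $f_i\in\mathcal{F}$, $x_i,y_i\in R$, and $\mathrm{Class}_\rho(f_i)\ne\mathsf{N/A}$ for every regime $\rho$ assigned to the carrier kind of $R$. Put $E_\rho=\{(x_i,y_i)\mid \mathrm{Class}_\rho(f_i)\in\{\mathsf{PRS},\mathsf{NEU}\}\}$; $\sim_\rho$ is the equivalence relation on $R$ generated by $E_\rho$, and $\pi_\rho=R/\!\sim_\rho$. Imported interface. The set $\mathcal{F}$, a finite inventory of nine regimes, their classification functions and the sibling function are fixed in advance. Sibling axes pair two regimes for one carrier kind: $\{\mathrm{LOC},\mathrm{OBJ}\}$ (plain referents: locus-fixed / object-fixed), $\{\mathrm{SCOPE\text{ - }E},\mathrm{SCOPE\text{ - }S}\}$ (scopes: extension-fixed / structure-fixed), $\{\mathrm{RULE\text{ - }C},\mathrm{RULE\text{ - }S}\}$ (rules: content-fixed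 / structure-fixed). $\mathrm{Sib}(\tau)=\tau'$ if $\{\tau,\tau'\}$ is an axis, and $\mathrm{Sib}(\tau)=\varnothing$ if $\tau$ is on no axis. For the carrier kind of rules the interface includes families with: refine-structure is $\mathsf{PRS}$ under RULE-C and $\mathsf{BRK}$ under RULE-S; revise-wording (content- and structure-preserving rewording) is $\mathsf{PRS}$ under both; amend-content (changing content, preserving section structure) is $\mathsf{BRK}$ under RULE-C and $\mathsf{PRS}$ under RULE-S. For plain referents, branch/fork is $\mathsf{PRS}$ under LOC and $\mathsf{BRK}$ under OBJ. Surfaces. A mechanism registry $D_B$ is a finite set of artifacts $d$, each with a total computable map $d:R\to V_d$. For nonempty finite $S\subseteq D_B$ the joint mechanism is $d_S(r)=\langle d(r)\mid d\in S\rangle$; $\mathcal{D}_B$ is the set of joint mechanisms. An audit surface over $R$ is a mechanism $d\in\mathcal{D}_B$ with a finite sequence $U_d=\langle u_1,\dots,u_m\rangle$ of computable identity-relevant uses $u_j:R\to O_j$ (outcome functions of designated types such as referent-identifier assignment), each of the form $u_j=\tilde u_j\circ d$ on $R$ for some $\tilde u_j:V_d\to O_j$. Registry and surface may be chosen freely. $\mathsf{IT}_d(r)=\langle u_1(r),\dots,u_m(r)\rangle$; $r\approx_d s$ iff $\mathsf{IT}_d(r)=\mathsf{IT}_d(s)$; $\pi_d=R/\!\approx_d$. Classification. $d$ is faithful to $\tau$ on $R$ when $r\sim_\tau s\Rightarrow r\approx_d s$ for all $r,s\in R$. With $\tau'=\mathrm{Sib}(\tau)\ne\varnothing$ put $\Delta^{\mathrm{op}}_d=\;\approx_d\cap\sim_\tau$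 and $\Delta^{\mathrm{sib}}=\;\sim_{\tau'}\cap\sim_\tau$. The surface $d$ exhibits sibling-aligned divergence when $d$ is not faithful to $\tau$ on $R$, $\mathrm{Sib}(\tau)=\tau'\neq\varnothing$, $\Delta^{\mathrm{sib}}\neq\;\sim_\tau$, and $\Delta^{\mathrm{op}}_d=\Delta^{\mathrm{sib}}$. The surface $d$ exhibits regime substitution on $R$ when $\mathrm{Sib}(\tau)=\tau'\neq\varnothing$, $\sim_\tau\neq\sim_{\tau'}$ on $R$, and $\pi_d=\pi_{\tau'}$ (equivalently $\approx_d=\sim_{\tau'}$ on $R$). -}

module Defs where

open import Data.Fin.Base using (Fin)
open import Data.Fin.Subset using (Subset; Nonempty)
open import Data.Fin.Subset.Properties using (_∈?_)
open import Data.List.Base using (List; filter; allFin)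
open import Data.List.Membership.Propositional using (_∈_)
open import Data.List.Relation.Unary.All as All using (All)
open import Data.Maybe.Base using (Maybe; just; nothing)
open import Data.Nat.Base using (ℕ)
open import Data.Product.Base using (∃-syntax; _×_; _,_)
open import Data.Sum.Base using (_⊎_)
open import Function.Base using (_∘_)
open import Function.Bundles using (_↔_)
open import Relation.Binary.Construct.Closure.Equivalence using (EqClosure)
open import Relation.Binary.Construct.Intersection using (_∩_)
open import Relation.Binary.Core using (Rel; _⇒_; _⇔_)
open import Relation.Binary.PropositionalEquality.Core using (_≡_; _≢_; _≗_)
open import Relation.Nullary.Negation.Core using (¬_)

data Verdict : Set where
  PRS BRK NEU N/A : Verdict

-- The inventory has nine regimes: six lie on the three sibling axes, and the
-- remaining three, whose names play no role, lie on none.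
data Regime : Set where
  LOC OBJ SCOPE-E SCOPE-S RULE-C RULE-S : Regime
  unpaired : Fin 3 → Regime

Sib : Regime → Maybe Regime
Sib LOC          = just OBJ
Sib OBJ          = just LOC
Sib SCOPE-E      = just SCOPE-S
Sib SCOPE-S      = just SCOPE-E
Sib RULE-C       = just RULE-S
Sib RULE-S       = just RULE-C
Sib (unpaired _) = nothing

data CarrierKind (Other : Set) : Set where
  referent scope rule : CarrierKind Other
  other : Other → CarrierKind Other

-- The data fixed in advance, constrained exactly by what is known about them.
record Interface : Set₁ where
  field
    OtherKind : Set

  Kind : Set
  Kind = CarrierKind OtherKind

  field
    regimesFor : Kind → List Regime
    LOC∈       : LOC     ∈ regimesFor referent
    OBJ∈       : OBJ     ∈ regimesFor referent
    SCOPE-E∈   : SCOPE-E ∈ regimesFor scope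
    SCOPE-S∈   : SCOPE-S ∈ regimesFor scope
    RULE-C∈    : RULE-C  ∈ regimesFor rule
    RULE-S∈    : RULE-S  ∈ regimesFor rule

    Family        : Set
    familyCount   : ℕ
    family-finite : Family ↔ Fin familyCount
    Class         : Regime → Family → Verdict

  -- f is a family for the carrier kind k, i.e. it may label the steps of
  -- histories over records of that kind.
  _FamilyFor_ : Family → Kind → Set
  f FamilyFor k = ∀ ρ → ρ ∈ regimesFor k → Class ρ f ≢ N/A

  field
    refine-structure     : Family
    refine-structure-for : refine-structure FamilyFor rule
    refine-structure-C   : Class RULE-C refine-structure ≡ PRS
    refine-structure-S   : Class RULE-S refine-structure ≡ BRK

    revise-wording       : Family
    revise-wording-for   : revise-wording FamilyFor rule
    revise-wording-C     : Class RULE-C revise-wording ≡ PRS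
    revise-wording-S     : Class RULE-S revise-wording ≡ PRS

    amend-content        : Family
    amend-content-for    : amend-content FamilyFor rule
    amend-content-C      : Class RULE-C amend-content ≡ BRK
    amend-content-S      : Class RULE-S amend-content ≡ PRS

    branch/fork          : Family
    branch/fork-for      : branch/fork FamilyFor referent
    branch/fork-LOC      : Class LOC branch/fork ≡ PRS
    branch/fork-OBJ      : Class OBJ branch/fork ≡ BRK

    -- A designated type labels a use; it does not constrain the outcome set.
    UseType                        : Set
    referent-identifier-assignment : UseType

module _ (I : Interface) where
  open Interface I

  record RecordDomain (k : Kind) : Set₁ where
    field
      Carrier : Set
      size    : ℕ
      finite  : Carrier ↔ Fin size

  open RecordDomain using (Carrier)

  record History {k : Kind} (R : RecordDomain k) : Set where
    field
      steps      : List (Family × Carrier R × Carrier R)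
      applicable : All (λ (f , _ , _) → f FamilyFor k) steps

  module _ {k : Kind} {R : RecordDomain k} (H : History R) where
    open History H

    IdentityStep : Regime → Rel (Carrier R) _
    IdentityStep ρ x y =
      ∃[ f ] (f , x , y) ∈ steps × (Class ρ f ≡ PRS ⊎ Class ρ f ≡ NEU)

    DeclaredIdentity : Regime → Rel (Carrier R) _
    DeclaredIdentity ρ = EqClosure (IdentityStep ρ)

  -- Artifact and use functions are Agda functions, whence their totality and
  -- computability.
  record Registry {k : Kind} (R : RecordDomain k) : Set₁ where
    field
      artifactCount : ℕ
      Value         : Fin artifactCount → Set
      artifact      : ∀ i → Carrier R → Value i

    members : Subset artifactCount → List (Fin artifactCount)
    members S = filter (_∈? S) (allFin artifactCount)

    -- All P xs is the type of tuples with one component in P x for each x in xs.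
    JointValue : Subset artifactCount → Set
    JointValue S = All Value (members S)

    joint : ∀ S → Carrier R → JointValue S
    joint S r = All.universal (λ i → artifact i r) (members S)

  record AuditSurface {k : Kind} (R : RecordDomain k) : Set₁ where
    field
      registry : Registry R

    open Registry registry public

    field
      selected : Subset artifactCount
      nonempty : Nonempty selected

      useCount : ℕ
      useType  : Fin useCount → UseType
      Outcome  : Fin useCount → Set
      use      : ∀ j → Carrier R → Outcome j
      factors  : ∀ j → ∃[ ũ ] use j ≗ ũ ∘ joint selected

    IT : Carrier R → All Outcome (allFin useCount)
    IT r = All.universal (λ j → use j r) (allFin useCount)

    _≈_ : Rel (Carrier R) _
    r ≈ s = IT r ≡ IT s

  module _ {k : Kind} {R : RecordDomain k} (τ : Regime) (H : History R)
           (d : AuditSurface R) where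
    open AuditSurface d using (_≈_)

    private
      ∼[_] : Regime → Rel (Carrier R) _
      ∼[_] = DeclaredIdentity H

    Faithful : Set
    Faithful = ∼[ τ ] ⇒ _≈_

    Δᵒᵖ : Rel (Carrier R) _
    Δᵒᵖ = _≈_ ∩ ∼[ τ ]

    Δˢⁱᵇ : Regime → Rel (Carrier R) _
    Δˢⁱᵇ τ′ = ∼[ τ′ ] ∩ ∼[ τ ]

    -- Equality of relations is mutual inclusion _⇔_.
    SiblingAlignedDivergence : Set
    SiblingAlignedDivergence =
      ¬ Faithful ×
      ∃[ τ′ ] Sib τ ≡ just τ′ × ¬ (Δˢⁱᵇ τ′ ⇔ ∼[ τ ]) × (Δᵒᵖ ⇔ Δˢⁱᵇ τ′)

    -- The quotients of R by two equivalence relations coincide exactly when the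
    -- relations do, so the partition equality is stated on the relations.
    RegimeSubstitution : Set
    RegimeSubstitution =
      ∃[ τ′ ] Sib τ ≡ just τ′ × ¬ (∼[ τ ] ⇔ ∼[ τ′ ]) × (_≈_ ⇔ ∼[ τ′ ])

{-# OPTIONS --safe #-}

-- Take three plain referents 0, 1, 2 and a single fork from 0 to 1.  Under LOC
-- the classes are {0, 1} and {2}; under OBJ all referents are distinct.  A
-- surface with classes {0, 2} and {1} splits 0 from 1, just as OBJ does inside
-- the LOC-classes, but it also merges 0 with 2, which OBJ keeps apart.  The
-- third referent is essential: the surface must depart from OBJ across distinct
-- LOC-classes.
module Submission where

open import Defs
open import Data.Bool.Base using (Bool; true; false)
open import Data.Fin.Base using (Fin)
open import Data.Fin.Patterns using (0F; 1F; 2F)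
open import Data.Fin.Subset using (⊤)
open import Data.Fin.Subset.Properties using (∈⊤)
open import Data.List.Base using ([]; _∷_)
open import Data.List.Membership.Propositional using (_∈_)
open import Data.List.Relation.Unary.All as All using ([]; _∷_)
open import Data.List.Relation.Unary.Any using (here)
open import Data.Maybe.Base using (just)
open import Data.Product.Base using (Σ; ∃-syntax; _×_; _,_; proj₁)
open import Data.Sum.Base using (inj₁; inj₂)
open import Function.Base using (id)
open import Function.Construct.Identity using (↔-id)
open import Relation.Binary.Construct.Closure.Equivalence
  using (gfold; reflexive; return)
open import Relation.Binary.PropositionalEquality.Core
  using (_≡_; refl; sym; trans; cong)
open import Relation.Binary.PropositionalEquality.Properties
  using (isEquivalence)
open import Relation.Nullary.Negation.Core using (¬_)

-- An invariant of the fork under LOC: both ends, 0 and 1, get the same value.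
locus : Fin 3 → Bool
locus 0F = false
locus 1F = false
locus 2F = true

identifier : Fin 3 → Bool
identifier 0F = false
identifier 1F = true
identifier 2F = false

-- The partitions {0, 2}, {1} and {0, 1}, {2} meet only in singletons, so inside a LOC-class the
-- surface is as fine as OBJ.
identifier-locus-injective :
  ∀ r s → identifier r ≡ identifier s → locus r ≡ locus s → r ≡ s
identifier-locus-injective 0F 0F _  _  = refl
identifier-locus-injective 0F 1F () _
identifier-locus-injective 0F 2F _  ()
identifier-locus-injective 1F 0F () _
identifier-locus-injective 1F 1F _  _  = refl
identifier-locus-injective 1F 2F () _
identifier-locus-injective 2F 0F _  ()
identifier-locus-injective 2F 1F () _
identifier-locus-injective 2F 2F _  _  = refl

module _ (I : Interface) where
  open Interface I

  referents : RecordDomain I referent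
  referents = record { Carrier = Fin 3 ; size = 3 ; finite = ↔-id (Fin 3) }

  forkHistory : History I referents
  forkHistory = record
    { steps      = (branch/fork , 0F , 1F) ∷ []
    ; applicable = branch/fork-for ∷ []
    }

  identifierRegistry : Registry I referents
  identifierRegistry = record
    { artifactCount = 1
    ; Value         = λ _ → Bool
    ; artifact      = λ _ → identifier
    }

  identifierSurface : AuditSurface I referents
  identifierSurface = record
    { registry = identifierRegistry
    ; selected = ⊤
    ; nonempty = 0F , ∈⊤
    ; useCount = 1
    ; useType  = λ _ → referent-identifier-assignment
    ; Outcome  = λ _ → Bool
    ; use      = λ _ → identifier
    -- With the sole artifact selected, the joint value is a one-entry tuple.
    ; factors  = λ _ → All.head , λ _ → refl
    }

  open AuditSurface identifierSurface using (IT; _≈_)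

  private
    _∼ᴸ_ _∼ᴼ_ : Fin 3 → Fin 3 → Set
    _∼ᴸ_ = DeclaredIdentity I forkHistory LOC
    _∼ᴼ_ = DeclaredIdentity I forkHistory OBJ

  -- The kernel of `locus` is an equivalence containing the only step, hence contains the closure.
  ∼ᴸ⇒locus≡ : ∀ {r s} → r ∼ᴸ s → locus r ≡ locus s
  ∼ᴸ⇒locus≡ = gfold isEquivalence locus λ { (_ , here refl , _) → refl }

  -- The fork is `BRK` under OBJ, so no step generates anything.
  ∼ᴼ⇒≡ : ∀ {r s} → r ∼ᴼ s → r ≡ s
  ∼ᴼ⇒≡ = gfold isEquivalence id step⇒≡
    where
    step⇒≡ : ∀ {r s} → IdentityStep I forkHistory OBJ r s → r ≡ s
    step⇒≡ (_ , here refl , inj₁ prs) with () ← trans (sym branch/fork-OBJ) prs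
    step⇒≡ (_ , here refl , inj₂ neu) with () ← trans (sym branch/fork-OBJ) neu

  ≡⇒∼ᴼ : ∀ {r s} → r ≡ s → r ∼ᴼ s
  ≡⇒∼ᴼ refl = reflexive (IdentityStep I forkHistory OBJ)

  ≈⇒identifier≡ : ∀ {r s} → r ≈ s → identifier r ≡ identifier s
  ≈⇒identifier≡ = cong All.head

  0∼ᴸ1 : 0F ∼ᴸ 1F
  0∼ᴸ1 = return (branch/fork , here refl , inj₁ branch/fork-LOC)

  divergence : SiblingAlignedDivergence I LOC forkHistory identifierSurface
  divergence = unfaithful , OBJ , refl , proper , op⇒sib , sib⇒op
    where
    unfaithful : ¬ Faithful I LOC forkHistory identifierSurface
    unfaithful faithful with () ← ≈⇒identifier≡ {0F} {1F} (faithful 0∼ᴸ1)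

    proper : ¬ (_ × (∀ {r s} → r ∼ᴸ s → r ∼ᴼ s × r ∼ᴸ s))
    -- Only the inclusion of `_∼ᴸ_` in the intersection can fail; it does at the pair 0, 1.
    proper (_ , ∼ᴸ⇒sib) with () ← ∼ᴼ⇒≡ (proj₁ (∼ᴸ⇒sib 0∼ᴸ1))

    op⇒sib : ∀ {r s} → r ≈ s × r ∼ᴸ s → r ∼ᴼ s × r ∼ᴸ s
    op⇒sib {r} {s} (r≈s , r∼s) =
      ≡⇒∼ᴼ (identifier-locus-injective r s (≈⇒identifier≡ {r} {s} r≈s) (∼ᴸ⇒locus≡ r∼s)) , r∼s

    sib⇒op : ∀ {r s} → r ∼ᴼ s × r ∼ᴸ s → r ≈ s × r ∼ᴸ s
    sib⇒op (r∼ᴼs , r∼ᴸs) = cong IT (∼ᴼ⇒≡ r∼ᴼs) , r∼ᴸs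

  no-substitution : ¬ RegimeSubstitution I LOC forkHistory identifierSurface
  -- The first `refl` forces the sibling to be `OBJ`. Referents 0 and 2 share an identifier, so
  -- substitution would make them equal.
  no-substitution (_ , refl , _ , ≈⇒∼ᴼ , _) with () ← ∼ᴼ⇒≡ (≈⇒∼ᴼ {0F} {2F} refl)

proposition4p14 : (I : Interface) → let open Interface I in
    Σ Kind λ k →
    ∃[ τ ] ∃[ τ′ ] τ ∈ regimesFor k × Sib τ ≡ just τ′ ×
    Σ (RecordDomain I k) λ R →
    Σ (History I R) λ H →
    Σ (AuditSurface I R) λ d →
    SiblingAlignedDivergence I τ H d ×
    ¬ RegimeSubstitution I τ H d
proposition4p14 I =
  referent , LOC , OBJ , LOC∈ , refl ,
  referents I , forkHistory I , identifierSurface I ,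
  divergence I , no-substitution I
  where open Interface I
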